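{- Let $m_1, m_2$ be integers with $m_1 \ge 4$ and $m_2 \ge 3$. Then \[ \mathsf{D}_{\pm}(C_{m_1} \oplus C_{m_2}) \ge \lfloor \log_2 (m_1/3) \rfloor + \lfloor \log_2 (m_2/3) \rfloor + 4. \]
   Context: $C_m$ denotes a cyclic group of order $m$ (no divisibility relation between $m_1$ and $m_2$ is assumed). For a finite abelian group $G$ (written additively), $\mathsf{D}_{\pm}(G)$ is the smallest positive integer $\ell$ such that for every sequence $g_1,\dots,g_k$ of elements of $G$ (repetitions allowed) with $k \ge \ell$ there exist a non-empty subset $I \subset \{1,\dots,k\}$ and $a_i \in \{+1,-1\}$ ($i\in I$) with $\sum_{i \in I} a_i g_i = 0$. -}

module Defs where

open import Data.Nat using (ℕ; zero; suc; _≤_; _<_)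
open import Data.Integer as ℤ using (ℤ; +_; -_)
open import Data.Integer.Divisibility using (_∣_)
open import Data.Fin using (Fin; toℕ)
import Data.Fin as Fin
open import Data.Fin.Subset using (Subset; _∈_)
open import Data.Fin.Subset.Properties using (_∈?_)
open import Data.Sign using (Sign)
open import Data.Product using (_×_; _,_; proj₁; proj₂; ∃)
open import Relation.Nullary using (yes; no)

-- Finite sum over Fin k of an integer-valued function.
Σℤ : (k : ℕ) → (Fin k → ℤ) → ℤ
Σℤ zero    f = + 0
Σℤ (suc k) f = f Fin.zero ℤ.+ Σℤ k (λ i → f (Fin.suc i))

-- The sign +1 / -1 as an integer.
signℤ : Sign → ℤ
signℤ Sign.+ = + 1
signℤ Sign.- = - (+ 1)

-- The group C_m1 ⊕ C_m2 = ℤ/m1 ⊕ ℤ/m2, elements represented by their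
-- canonical residues (Fin m1 × Fin m2).
C⊕C : ℕ → ℕ → Set
C⊕C m₁ m₂ = Fin m₁ × Fin m₂

-- The element Σ_{i ∈ I} a_i g_i of C_m1 ⊕ C_m2 is zero: both coordinates
-- of the integer lift vanish modulo m1, resp. m2.
SignedSubsumZero : (m₁ m₂ k : ℕ) → (Fin k → C⊕C m₁ m₂) → Subset k → (Fin k → Sign) → Set
SignedSubsumZero m₁ m₂ k g I a =
  (+ m₁ ∣ Σℤ k (λ i → term i (λ x → toℕ (proj₁ x))))
  × (+ m₂ ∣ Σℤ k (λ i → term i (λ x → toℕ (proj₂ x))))
  where
  term : Fin k → (C⊕C m₁ m₂ → ℕ) → ℤ
  term i c with i ∈? I
  ... | yes _ = signℤ (a i) ℤ.* (+ c (g i))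
  ... | no  _ = + 0

-- The sequence g_1..g_k has a non-empty plus-minus weighted zero-sum subsequence.
HasPMZeroSum : (m₁ m₂ k : ℕ) → (Fin k → C⊕C m₁ m₂) → Set
HasPMZeroSum m₁ m₂ k g =
  ∃ λ (I : Subset k) → (∃ λ i → i ∈ I) × ∃ λ (a : Fin k → Sign) → SignedSubsumZero m₁ m₂ k g I a

-- ℓ has the defining property: every sequence of length k ≥ ℓ has one.
PMProperty : (m₁ m₂ ℓ : ℕ) → Set
PMProperty m₁ m₂ ℓ = ∀ k → ℓ ≤ k → (g : Fin k → C⊕C m₁ m₂) → HasPMZeroSum m₁ m₂ k g

-- ℓ = D_±(C_m1 ⊕ C_m2): the smallest positive integer with the property.
IsDpm : (m₁ m₂ ℓ : ℕ) → Set
IsDpm m₁ m₂ ℓ = (0 < ℓ) × PMProperty m₁ m₂ ℓ × (∀ ℓ' → 0 < ℓ' → PMProperty m₁ m₂ ℓ' → ℓ ≤ ℓ')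

{-# OPTIONS --safe #-}
module Submission where

-- Let a = ⌊log₂ (m₁/3)⌋ and b = ⌊log₂ (m₂/3)⌋, so that 3·2^a ≤ m₁ and 3·2^b ≤ m₂; it suffices to
-- exhibit a sequence of length a + b + 3 without a nonempty ±-weighted zero-sum. Take the powers
-- 2^(s-1), …, 2, 1 in the first coordinate, 2^(b-1), …, 2, 1 in the second, and a core of
-- elements (2^s x_j, 2^b y_j). A ±-combination of a block of powers is a binary expansion with
-- digits in {-1, 0, 1}: of absolute value < 2^s, and nonzero unless all digits vanish. So the first
-- coordinate of a ±-combination is X·2^s + P, where X combines the x_j and P the powers, with
-- ∣P∣ < 2^s; it is nonzero if X or P is, and of absolute value < T·2^s ≤ m₁ if ∣X∣ < T. The same
-- holds in the second coordinate. For a ≥ 1 take s = a - 1 and the core (1,-1), (1,0), (1,1), (3,1):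
-- every nonempty ±-combination of it has 0 < ∣X∣ < 6 or 0 < ∣Y∣ < 3, which is checked by
-- enumerating all 3^4 selections. For a = 0 the core is empty and the blocks have lengths 2
-- (as m₁ ≥ 4) and b + 1.

open import Defs
open import Data.Nat as ℕ using (ℕ; zero; suc; _≤_; _<_; _^_; NonZero; z≤n; s≤s)
import Data.Nat.Properties as ℕ
open import Data.Nat.DivMod using (m/n*n≤m; m≥n⇒m/n>0)
import Data.Nat.Divisibility as ℕ
open import Data.Nat.Logarithm using (⌊log₂_⌋)
open import Data.Nat.Logarithm.Core using (⌊log2⌋)
open import Induction.WellFounded using (acc)
open import Data.Integer as ℤ using (ℤ; +_; -_; 0ℤ; 1ℤ; -1ℤ; _+_; _*_; ∣_∣)
import Data.Integer.Properties as ℤ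
open import Data.Integer.Divisibility using (_∣_)
import Data.Integer.Divisibility.Signed as Signed
open import Data.Integer.DivMod using (_/ℕ_; n%ℕd<d; a≡a%ℕn+[a/ℕn]*n)
open import Data.Integer.Tactic.RingSolver using (solve-∀)
import Data.Nat.Tactic.RingSolver as ℕ-Solver
open import Algebra.Properties.Semiring.Sum ℤ.+-*-semiring
  using (sum; sum-cong-≗; sum-replicate-zero; ∑-distrib-+; *-distribˡ-sum; *-distribʳ-sum)
open import Algebra.Properties.AbelianGroup ℤ.+-0-abelianGroup using (inverseˡ-unique)
open import Data.Fin as Fin using (Fin; toℕ; fromℕ<; _↑ˡ_; _↑ʳ_)
open import Data.Fin.Properties using (toℕ-fromℕ<; splitAt⁻¹-↑ˡ; splitAt⁻¹-↑ʳ; all?)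
open import Data.Fin.Subset using (Subset; _∈_)
open import Data.Fin.Subset.Properties using (_∈?_)
open import Data.Vec.Functional using (Vector; []; _∷_; _++_; take; drop; replicate; map)
open import Data.Vec.Functional.Properties using (lookup-++ˡ; lookup-++ʳ)
open import Data.Maybe using (Maybe; just; nothing)
import Data.Maybe.Properties as Maybe
open import Data.Sign as Sign using (Sign)
import Data.Sign.Properties as Sign
open import Data.Product using (_×_; _,_; proj₁; proj₂; ∃)
open import Data.Sum using (_⊎_; inj₁; inj₂; [_,_]′)
import Data.Sum as Sum
open import Data.Empty using (⊥)
open import Function using (_∘_)
open import Relation.Nullary using (Dec; ¬_; yes; no; ¬?; _×-dec_; _⊎-dec_; contradiction)
open import Relation.Nullary.Decidable using (map′; from-yes)
open import Relation.Unary using (Decidable)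
open import Relation.Binary.PropositionalEquality
  using (_≡_; _≢_; refl; sym; trans; cong; cong₂; subst; module ≡-Reasoning)

-- Signed selections

Selection : ℕ → Set
Selection k = Fin k → Maybe Sign

weight : Maybe Sign → ℤ
weight nothing  = 0ℤ
weight (just s) = signℤ s

∣weight∣<2 : ∀ t → ∣ weight t ∣ < 2
∣weight∣<2 nothing         = s≤s z≤n
∣weight∣<2 (just Sign.+)   = s≤s (s≤s z≤n)
∣weight∣<2 (just Sign.-)   = s≤s (s≤s z≤n)

weight≢0 : ∀ {t} → t ≢ nothing → weight t ≢ 0ℤ
weight≢0 {nothing}      t≢nothing _  = t≢nothing refl
weight≢0 {just Sign.+}  _         ()
weight≢0 {just Sign.-}  _         ()

Σ± : ∀ {k} → Selection k → Vector ℤ k → ℤ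
Σ± c x = sum (λ i → weight (c i) * x i)

Empty : ∀ {k} → Selection k → Set
Empty c = ∀ i → c i ≡ nothing

NonEmpty : ∀ {k} → Selection k → Set
NonEmpty c = ∃ λ i → c i ≢ nothing

Σ±-cong : ∀ {k} {c c′ : Selection k} (x : Vector ℤ k) → (∀ i → c i ≡ c′ i) → Σ± c x ≡ Σ± c′ x
Σ±-cong x c≗c′ = sum-cong-≗ (λ i → cong (λ t → weight t * x i) (c≗c′ i))

Σ±-empty : ∀ {k} {c : Selection k} (x : Vector ℤ k) → Empty c → Σ± c x ≡ 0ℤ
Σ±-empty {k} x empty = trans (sum-cong-≗ (λ i → cong (λ t → weight t * x i) (empty i)))
                             (sum-replicate-zero k)

Σ±-zeros : ∀ {k} (c : Selection k) → Σ± c (replicate k 0ℤ) ≡ 0ℤ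
Σ±-zeros {k} c = trans (sum-cong-≗ (λ i → ℤ.*-zeroʳ (weight (c i)))) (sum-replicate-zero k)

Σ±-scale : ∀ {k} (c : Selection k) α (x : Vector ℤ k) → Σ± c (map (α *_) x) ≡ α * Σ± c x
Σ±-scale c α x = trans (sum-cong-≗ (λ i → reassoc (weight (c i)) α (x i)))
                       (sym (*-distribˡ-sum α (λ i → weight (c i) * x i)))
  where
  reassoc : ∀ w α y → w * (α * y) ≡ α * (w * y)
  reassoc = solve-∀

sum-take-drop : ∀ m {n} (f : Vector ℤ (m ℕ.+ n)) → sum f ≡ sum (take m f) + sum (drop m f)
sum-take-drop zero    f = sym (ℤ.+-identityˡ (sum f))
sum-take-drop (suc m) f = trans (cong (λ r → f Fin.zero + r) (sum-take-drop m (f ∘ Fin.suc)))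
                                (sym (ℤ.+-assoc (f Fin.zero) _ _))

Σ±-++ : ∀ m {n} (c : Selection (m ℕ.+ n)) (x : Vector ℤ m) (y : Vector ℤ n) →
        Σ± c (x ++ y) ≡ Σ± (take m c) x + Σ± (drop m c) y
Σ±-++ m c x y = trans (sum-take-drop m _) (cong₂ _+_
  (sum-cong-≗ (λ i → cong (weight (c (i ↑ˡ _)) *_) (lookup-++ˡ x y i)))
  (sum-cong-≗ (λ i → cong (weight (c (m ↑ʳ i)) *_) (lookup-++ʳ x y i))))

nonEmpty-split : ∀ m {n} (c : Selection (m ℕ.+ n)) →
                 NonEmpty c → NonEmpty (take m c) ⊎ NonEmpty (drop m c)
nonEmpty-split m c (i , cᵢ≢nothing) with Fin.splitAt m i in eq
... | inj₁ j = inj₁ (j , subst (λ i → c i ≢ nothing) (sym (splitAt⁻¹-↑ˡ eq)) cᵢ≢nothing)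
... | inj₂ j = inj₂ (j , subst (λ i → c i ≢ nothing) (sym (splitAt⁻¹-↑ʳ eq)) cᵢ≢nothing)

-- Mixed-radix estimates

¬∣-small : ∀ {m} z → 0 < ∣ z ∣ → ∣ z ∣ < m → ¬ (+ m ∣ z)
¬∣-small z 0<∣z∣ ∣z∣<m = ℕ.>⇒∤ {{ℕ.>-nonZero 0<∣z∣}} ∣z∣<m

∣radix∣< : ∀ {α T} X P → ∣ P ∣ < α → ∣ X ∣ < T → ∣ X * + α + P ∣ < T ℕ.* α
∣radix∣< {α} {T} X P ∣P∣<α ∣X∣<T = begin-strict
  ∣ X * + α + P ∣           ≤⟨ ℤ.∣i+j∣≤∣i∣+∣j∣ (X * + α) P ⟩
  ∣ X * + α ∣ ℕ.+ ∣ P ∣     ≡⟨ cong (ℕ._+ ∣ P ∣) (ℤ.abs-* X (+ α)) ⟩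
  ∣ X ∣ ℕ.* α ℕ.+ ∣ P ∣     <⟨ ℕ.+-monoʳ-< (∣ X ∣ ℕ.* α) ∣P∣<α ⟩
  ∣ X ∣ ℕ.* α ℕ.+ α         ≡⟨ ℕ.+-comm (∣ X ∣ ℕ.* α) α ⟩
  suc ∣ X ∣ ℕ.* α           ≤⟨ ℕ.*-monoˡ-≤ α ∣X∣<T ⟩
  T ℕ.* α                   ∎
  where open ℕ.≤-Reasoning

-- A nonzero leading digit X dominates the lower-order part P, since ∣ P ∣ < α ≤ ∣ X * α ∣.
radix≢0 : ∀ {α} X P → ∣ P ∣ < α → X ≢ 0ℤ ⊎ P ≢ 0ℤ → X * + α + P ≢ 0ℤ
radix≢0 {α} X P ∣P∣<α X≢0⊎P≢0 Xα+P≡0 with X ℤ.≟ 0ℤ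
... | yes refl = [ (λ X≢0 → X≢0 refl) , (λ P≢0 → P≢0 (trans (sym (ℤ.+-identityˡ P)) Xα+P≡0)) ]′
                   X≢0⊎P≢0
... | no X≢0 = ℕ.<⇒≱ ∣P∣<α (begin
  α                 ≤⟨ ℕ.m≤n*m α ∣ X ∣ {{ℕ.≢-nonZero (X≢0 ∘ ℤ.∣i∣≡0⇒i≡0)}} ⟩
  ∣ X ∣ ℕ.* α       ≡⟨ ℤ.abs-* X (+ α) ⟨
  ∣ X * + α ∣       ≡⟨ cong ∣_∣ (inverseˡ-unique (X * + α) P Xα+P≡0) ⟩
  ∣ - P ∣           ≡⟨ ℤ.∣-i∣≡∣i∣ P ⟩
  ∣ P ∣             ∎)
  where open ℕ.≤-Reasoning

¬∣radix : ∀ {m α T} X P → ∣ P ∣ < α → ∣ X ∣ < T → T ℕ.* α ≤ m → X ≢ 0ℤ ⊎ P ≢ 0ℤ →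
          ¬ (+ m ∣ X * + α + P)
¬∣radix {α = α} X P ∣P∣<α ∣X∣<T Tα≤m X≢0⊎P≢0 = ¬∣-small (X * + α + P)
  (ℕ.n≢0⇒n>0 (radix≢0 X P ∣P∣<α X≢0⊎P≢0 ∘ ℤ.∣i∣≡0⇒i≡0))
  (ℕ.<-≤-trans (∣radix∣< X P ∣P∣<α ∣X∣<T) Tα≤m)

powers : ∀ s → Vector ℤ s
powers zero    = []
powers (suc s) = + (2 ^ s) ∷ powers s

∣Σ±-powers∣<2^s : ∀ s (c : Selection s) → ∣ Σ± c (powers s) ∣ < 2 ^ s
∣Σ±-powers∣<2^s zero    c = s≤s z≤n
∣Σ±-powers∣<2^s (suc s) c =
  ∣radix∣< (weight (c Fin.zero)) _ (∣Σ±-powers∣<2^s s (c ∘ Fin.suc)) (∣weight∣<2 (c Fin.zero))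

Σ±-powers≢0 : ∀ s (c : Selection s) → NonEmpty c → Σ± c (powers s) ≢ 0ℤ
Σ±-powers≢0 (suc s) c (i , cᵢ≢nothing) = radix≢0 (weight (c Fin.zero)) _
  (∣Σ±-powers∣<2^s s (c ∘ Fin.suc)) (digit i cᵢ≢nothing)
  where
  digit : ∀ i → c i ≢ nothing → weight (c Fin.zero) ≢ 0ℤ ⊎ Σ± (c ∘ Fin.suc) (powers s) ≢ 0ℤ
  digit Fin.zero    c₀≢nothing = inj₁ (weight≢0 c₀≢nothing)
  digit (Fin.suc i) cᵢ≢nothing = inj₂ (Σ±-powers≢0 s (c ∘ Fin.suc) (i , cᵢ≢nothing))

-- Signed zero-sums in C_m₁ ⊕ C_m₂ as integer divisibilities

selection : ∀ {k} → Subset k → (Fin k → Sign) → Selection k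
selection I a i with i ∈? I
... | yes _ = just (a i)
... | no  _ = nothing

selection-nonEmpty : ∀ {k} (I : Subset k) a {i} → i ∈ I → selection I a i ≢ nothing
selection-nonEmpty I a {i} i∈I with i ∈? I
... | yes _   = λ ()
... | no i∉I  = contradiction i∈I i∉I

Σℤ≡sum : ∀ k (f : Vector ℤ k) → Σℤ k f ≡ sum f
Σℤ≡sum zero    f = refl
Σℤ≡sum (suc k) f = cong (λ r → f Fin.zero + r) (Σℤ≡sum k (f ∘ Fin.suc))

-- The summands of SignedSubsumZero are local to Defs; they are recovered from its proofs.
summands : ∀ {m k} {f : Vector ℤ k} → m ∣ Σℤ k f → Vector ℤ k
summands {f = f} _ = f

signedSubsumZero⇒∣Σ± : ∀ {m₁ m₂ k} (g : Fin k → C⊕C m₁ m₂) I a → SignedSubsumZero m₁ m₂ k g I a →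
  (+ m₁ ∣ Σ± (selection I a) (λ i → + toℕ (proj₁ (g i)))) ×
  (+ m₂ ∣ Σ± (selection I a) (λ i → + toℕ (proj₂ (g i))))
signedSubsumZero⇒∣Σ± {m₁} {m₂} {k} g I a (d₁ , d₂) =
  subst (+ m₁ ∣_) (trans (Σℤ≡sum k _) (sum-cong-≗ first)) d₁ ,
  subst (+ m₂ ∣_) (trans (Σℤ≡sum k _) (sum-cong-≗ second)) d₂
  where
  first : ∀ i → summands {+ m₁} d₁ i ≡ weight (selection I a i) * + toℕ (proj₁ (g i))
  first i with i ∈? I
  ... | yes _ = refl
  ... | no  _ = refl
  second : ∀ i → summands {+ m₂} d₂ i ≡ weight (selection I a i) * + toℕ (proj₂ (g i))
  second i with i ∈? I
  ... | yes _ = refl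
  ... | no  _ = refl

reduce : ∀ m .{{_ : NonZero m}} → ℤ → Fin m
reduce m z = fromℕ< (n%ℕd<d z m)

∣Σ±-reduce : ∀ m .{{_ : NonZero m}} {k} (c : Selection k) (x : Vector ℤ k) →
             + m ∣ Σ± c (λ i → + toℕ (reduce m (x i))) → + m ∣ Σ± c x
∣Σ±-reduce m c x d = Signed.∣⇒∣ᵤ (subst (Signed._∣_ (+ m)) (sym split)
  (Signed.∣m∣n⇒∣m+n (Signed.∣ᵤ⇒∣ {i = Σ± c remainder} d)
                     (Signed.∣n⇒∣m*n (Σ± c quotient) Signed.∣-refl)))
  where
  remainder quotient : Vector ℤ _
  remainder i = + toℕ (reduce m (x i))
  quotient  i = x i /ℕ m
  division : ∀ i → x i ≡ remainder i + quotient i * + m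
  division i = trans (a≡a%ℕn+[a/ℕn]*n (x i) m)
                     (cong (λ r → + r + quotient i * + m) (sym (toℕ-fromℕ< (n%ℕd<d (x i) m))))
  distrib : ∀ w r q n → w * (r + q * n) ≡ w * r + (w * q) * n
  distrib = solve-∀
  split : Σ± c x ≡ Σ± c remainder + Σ± c quotient * + m
  split = begin
    Σ± c x
      ≡⟨ sum-cong-≗ (λ i → trans (cong (weight (c i) *_) (division i))
                                 (distrib (weight (c i)) (remainder i) (quotient i) (+ m))) ⟩
    sum (λ i → weight (c i) * remainder i + (weight (c i) * quotient i) * + m)
      ≡⟨ ∑-distrib-+ (λ i → weight (c i) * remainder i) (λ i → (weight (c i) * quotient i) * + m) ⟩
    Σ± c remainder + sum (λ i → (weight (c i) * quotient i) * + m)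
      ≡⟨ cong (λ q → Σ± c remainder + q) (*-distribʳ-sum (+ m) (λ i → weight (c i) * quotient i)) ⟨
    Σ± c remainder + Σ± c quotient * + m
      ∎
    where open ≡-Reasoning

PlusMinusFree : ∀ m₁ m₂ {k} → Vector ℤ k → Vector ℤ k → Set
PlusMinusFree m₁ m₂ {k} u v = ∀ (c : Selection k) → NonEmpty c → + m₁ ∣ Σ± c u → + m₂ ∣ Σ± c v → ⊥

plusMinusFree⇒¬HasPMZeroSum : ∀ {m₁ m₂ k} .{{_ : NonZero m₁}} .{{_ : NonZero m₂}} (u v : Vector ℤ k) →
  PlusMinusFree m₁ m₂ u v → ¬ HasPMZeroSum m₁ m₂ k (λ i → reduce m₁ (u i) , reduce m₂ (v i))
plusMinusFree⇒¬HasPMZeroSum {m₁} {m₂} u v free (I , (i , i∈I) , a , zero-sum)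
  with signedSubsumZero⇒∣Σ± _ I a zero-sum
... | d₁ , d₂ = free (selection I a) (i , selection-nonEmpty I a i∈I)
                     (∣Σ±-reduce m₁ (selection I a) u d₁) (∣Σ±-reduce m₂ (selection I a) v d₂)

¬HasPMZeroSum⇒< : ∀ {m₁ m₂ ℓ k} {g : Fin k → C⊕C m₁ m₂} →
                  PMProperty m₁ m₂ ℓ → ¬ HasPMZeroSum m₁ m₂ k g → k < ℓ
¬HasPMZeroSum⇒< {k = k} {g} property free = ℕ.≰⇒> (λ ℓ≤k → free (property k ℓ≤k g))

-- The construction

Small : ℕ → ℤ → Set
Small T z = z ≢ 0ℤ × ∣ z ∣ < T

Bounded : ℕ → ℕ → ∀ {r} → Vector ℤ r → Vector ℤ r → Selection r → Set
Bounded T₁ T₂ x y c = Empty c ⊎ Small T₁ (Σ± c x) ⊎ Small T₂ (Σ± c y)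

CoreBound : ℕ → ℕ → ∀ {r} → Vector ℤ r → Vector ℤ r → Set
CoreBound T₁ T₂ x y = ∀ c → Bounded T₁ T₂ x y c

blocks₁ : ∀ s b {r} → Vector ℤ r → Vector ℤ (s ℕ.+ (b ℕ.+ r))
blocks₁ s b x = powers s ++ (replicate b 0ℤ ++ map (+ (2 ^ s) *_) x)

blocks₂ : ∀ s b {r} → Vector ℤ r → Vector ℤ (s ℕ.+ (b ℕ.+ r))
blocks₂ s b y = replicate s 0ℤ ++ (powers b ++ map (+ (2 ^ b) *_) y)

Σ±-blocks₁ : ∀ s b {r} (x : Vector ℤ r) c →
  Σ± c (blocks₁ s b x) ≡ Σ± (drop b (drop s c)) x * + (2 ^ s) + Σ± (take s c) (powers s)
Σ±-blocks₁ s b x c = begin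
  Σ± c (blocks₁ s b x)
    ≡⟨ Σ±-++ s c _ _ ⟩
  P + Σ± (drop s c) (replicate b 0ℤ ++ map (+ (2 ^ s) *_) x)
    ≡⟨ cong (λ z → P + z) (Σ±-++ b (drop s c) _ _) ⟩
  P + (Σ± (take b (drop s c)) (replicate b 0ℤ) + Σ± (drop b (drop s c)) (map (+ (2 ^ s) *_) x))
    ≡⟨ cong₂ (λ z₀ zₓ → P + (z₀ + zₓ)) (Σ±-zeros (take b (drop s c)))
                                        (Σ±-scale (drop b (drop s c)) (+ (2 ^ s)) x) ⟩
  P + (0ℤ + + (2 ^ s) * X)
    ≡⟨ rearrange P X (+ (2 ^ s)) ⟩
  X * + (2 ^ s) + P
    ∎
  where
  open ≡-Reasoning
  P = Σ± (take s c) (powers s)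
  X = Σ± (drop b (drop s c)) x
  rearrange : ∀ P X α → P + (0ℤ + α * X) ≡ X * α + P
  rearrange = solve-∀

Σ±-blocks₂ : ∀ s b {r} (y : Vector ℤ r) c →
  Σ± c (blocks₂ s b y) ≡ Σ± (drop b (drop s c)) y * + (2 ^ b) + Σ± (take b (drop s c)) (powers b)
Σ±-blocks₂ s b y c = begin
  Σ± c (blocks₂ s b y)
    ≡⟨ Σ±-++ s c _ _ ⟩
  Σ± (take s c) (replicate s 0ℤ) + Σ± (drop s c) (powers b ++ map (+ (2 ^ b) *_) y)
    ≡⟨ cong₂ _+_ (Σ±-zeros (take s c)) (Σ±-++ b (drop s c) _ _) ⟩
  0ℤ + (P + Σ± (drop b (drop s c)) (map (+ (2 ^ b) *_) y))
    ≡⟨ cong (λ z → 0ℤ + (P + z)) (Σ±-scale (drop b (drop s c)) (+ (2 ^ b)) y) ⟩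
  0ℤ + (P + + (2 ^ b) * Y)
    ≡⟨ rearrange P Y (+ (2 ^ b)) ⟩
  Y * + (2 ^ b) + P
    ∎
  where
  open ≡-Reasoning
  P = Σ± (take b (drop s c)) (powers b)
  Y = Σ± (drop b (drop s c)) y
  rearrange : ∀ P Y β → 0ℤ + (P + β * Y) ≡ Y * β + P
  rearrange = solve-∀

blocks-plusMinusFree : ∀ {m₁ m₂ T₁ T₂} s b {r} (x y : Vector ℤ r) →
  1 ≤ T₁ → 1 ≤ T₂ → T₁ ℕ.* 2 ^ s ≤ m₁ → T₂ ℕ.* 2 ^ b ≤ m₂ → CoreBound T₁ T₂ x y →
  PlusMinusFree m₁ m₂ (blocks₁ s b x) (blocks₂ s b y)
blocks-plusMinusFree {m₁} {m₂} {T₁} {T₂} s b x y 1≤T₁ 1≤T₂ T₁2ˢ≤m₁ T₂2ᵇ≤m₂ core c nonEmpty d₁ d₂ =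
  byCore (core (drop b (drop s c)))
  where
  X = Σ± (drop b (drop s c)) x
  Y = Σ± (drop b (drop s c)) y
  P₁ = Σ± (take s c) (powers s)
  P₂ = Σ± (take b (drop s c)) (powers b)

  ¬∣first : X ≢ 0ℤ ⊎ P₁ ≢ 0ℤ → ∣ X ∣ < T₁ → ⊥
  ¬∣first nonzero ∣X∣<T₁ =
    ¬∣radix X P₁ (∣Σ±-powers∣<2^s s (take s c)) ∣X∣<T₁ T₁2ˢ≤m₁ nonzero
    (subst (+ m₁ ∣_) (Σ±-blocks₁ s b x c) d₁)

  ¬∣second : Y ≢ 0ℤ ⊎ P₂ ≢ 0ℤ → ∣ Y ∣ < T₂ → ⊥
  ¬∣second nonzero ∣Y∣<T₂ =
    ¬∣radix Y P₂ (∣Σ±-powers∣<2^s b (take b (drop s c))) ∣Y∣<T₂ T₂2ᵇ≤m₂ nonzero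
    (subst (+ m₂ ∣_) (Σ±-blocks₂ s b y c) d₂)

  emptyCore : Empty (drop b (drop s c)) → ⊥
  emptyCore empty with nonEmpty-split s c nonEmpty
  ... | inj₁ nonEmpty₁ = ¬∣first (inj₂ (Σ±-powers≢0 s (take s c) nonEmpty₁))
                                 (subst (λ z → ∣ z ∣ < T₁) (sym (Σ±-empty x empty)) 1≤T₁)
  ... | inj₂ nonEmpty₂₃ with nonEmpty-split b (drop s c) nonEmpty₂₃
  ...   | inj₁ nonEmpty₂ = ¬∣second (inj₂ (Σ±-powers≢0 b (take b (drop s c)) nonEmpty₂))
                                    (subst (λ z → ∣ z ∣ < T₂) (sym (Σ±-empty y empty)) 1≤T₂)
  ...   | inj₂ (j , cⱼ≢nothing) = cⱼ≢nothing (empty j)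

  byCore : Bounded T₁ T₂ x y (drop b (drop s c)) → ⊥
  byCore (inj₁ empty)                  = emptyCore empty
  byCore (inj₂ (inj₁ (X≢0 , ∣X∣<T₁))) = ¬∣first (inj₁ X≢0) ∣X∣<T₁
  byCore (inj₂ (inj₂ (Y≢0 , ∣Y∣<T₂))) = ¬∣second (inj₁ Y≢0) ∣Y∣<T₂

nonZero : ∀ {T s m} → 1 ≤ T → T ℕ.* 2 ^ s ≤ m → NonZero m
nonZero {s = s} 1≤T T2ˢ≤m = ℕ.>-nonZero (ℕ.<-≤-trans (ℕ.*-mono-≤ 1≤T (ℕ.m^n>0 2 s)) T2ˢ≤m)

blocks-lowerBound : ∀ {m₁ m₂ ℓ T₁ T₂} s b {r} (x y : Vector ℤ r) → PMProperty m₁ m₂ ℓ →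
  1 ≤ T₁ → 1 ≤ T₂ → T₁ ℕ.* 2 ^ s ≤ m₁ → T₂ ℕ.* 2 ^ b ≤ m₂ → CoreBound T₁ T₂ x y →
  s ℕ.+ (b ℕ.+ r) < ℓ
blocks-lowerBound s b x y property 1≤T₁ 1≤T₂ T₁2ˢ≤m₁ T₂2ᵇ≤m₂ core =
  ¬HasPMZeroSum⇒< property (plusMinusFree⇒¬HasPMZeroSum (blocks₁ s b x) (blocks₂ s b y)
    (blocks-plusMinusFree s b x y 1≤T₁ 1≤T₂ T₁2ˢ≤m₁ T₂2ᵇ≤m₂ core))
  where
  instance
    _ = nonZero {s = s} 1≤T₁ T₁2ˢ≤m₁
    _ = nonZero {s = b} 1≤T₂ T₂2ᵇ≤m₂

-- The core

∀-maybeSign? : {Q : Maybe Sign → Set} → Decidable Q → Dec (∀ t → Q t)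
∀-maybeSign? Q? = map′
  (λ { (q₀ , q₊ , q₋) → λ { nothing → q₀ ; (just Sign.+) → q₊ ; (just Sign.-) → q₋ } })
  (λ q → q nothing , q (just Sign.+) , q (just Sign.-))
  (Q? nothing ×-dec Q? (just Sign.+) ×-dec Q? (just Sign.-))

∀-selection? : ∀ k {P : Selection k → Set} →
               (∀ {c c′} → (∀ i → c i ≡ c′ i) → P c → P c′) → Decidable P → Dec (∀ c → P c)
∀-selection? zero    respects P? = map′ (λ p c → respects (λ ()) p) (λ p → p []) (P? [])
∀-selection? (suc k) respects P? = map′
  (λ p c → respects (λ { Fin.zero → refl ; (Fin.suc i) → refl }) (p (c Fin.zero) (c ∘ Fin.suc)))
  (λ p t c → p (t ∷ c))
  (∀-maybeSign? (λ t → ∀-selection? k (λ e → respects (λ { Fin.zero → refl ; (Fin.suc i) → e i }))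
                                         (λ c → P? (t ∷ c))))

coreBound? : ∀ T₁ T₂ {r} (x y : Vector ℤ r) → Dec (CoreBound T₁ T₂ x y)
coreBound? T₁ T₂ {r} x y = ∀-selection? r respects bounded?
  where
  respects : ∀ {c c′} → (∀ i → c i ≡ c′ i) → Bounded T₁ T₂ x y c → Bounded T₁ T₂ x y c′
  respects c≗c′ = Sum.map (λ empty i → trans (sym (c≗c′ i)) (empty i))
                    (Sum.map (subst (Small T₁) (Σ±-cong x c≗c′)) (subst (Small T₂) (Σ±-cong y c≗c′)))
  small? : ∀ T z → Dec (Small T z)
  small? T z = ¬? (z ℤ.≟ 0ℤ) ×-dec (∣ z ∣ ℕ.<? T)
  bounded? : ∀ c → Dec (Bounded T₁ T₂ x y c)
  bounded? c = all? (λ i → Maybe.≡-dec Sign._≟_ (c i) nothing)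
               ⊎-dec (small? T₁ (Σ± c x) ⊎-dec small? T₂ (Σ± c y))

emptyCoreBound : ∀ {T₁ T₂} → CoreBound T₁ T₂ [] []
emptyCoreBound c = inj₁ (λ ())

coreˣ coreʸ : Vector ℤ 4
coreˣ = 1ℤ ∷ 1ℤ ∷ 1ℤ ∷ + 3 ∷ []
coreʸ = -1ℤ ∷ 0ℤ ∷ 1ℤ ∷ 1ℤ ∷ []

coreBound : CoreBound 6 3 coreˣ coreʸ
coreBound = from-yes (coreBound? 6 3 coreˣ coreʸ)

2^⌊log2⌋n≤n : ∀ n {acc} .{{_ : NonZero n}} → 2 ^ ⌊log2⌋ n acc ≤ n
2^⌊log2⌋n≤n 1                         = ℕ.≤-refl
2^⌊log2⌋n≤n (suc (suc n)) {acc below} = begin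
  2 ℕ.* 2 ^ ⌊log2⌋ (suc h) _  ≤⟨ ℕ.*-monoʳ-≤ 2 (2^⌊log2⌋n≤n (suc h)) ⟩
  2 ℕ.* suc h                 ≡⟨ ℕ.*-suc 2 h ⟩
  2 ℕ.+ (h ℕ.+ (h ℕ.+ 0))     ≡⟨ cong (λ z → 2 ℕ.+ (h ℕ.+ z)) (ℕ.+-identityʳ h) ⟩
  2 ℕ.+ (h ℕ.+ h)             ≤⟨ ℕ.+-monoʳ-≤ 2 (ℕ.+-monoʳ-≤ h (ℕ.⌊n/2⌋≤⌈n/2⌉ n)) ⟩
  2 ℕ.+ (h ℕ.+ ℕ.⌈ n /2⌉)     ≡⟨ cong (2 ℕ.+_) (ℕ.⌊n/2⌋+⌈n/2⌉≡n n) ⟩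
  2 ℕ.+ n                     ∎
  where
  open ℕ.≤-Reasoning
  h = ℕ.⌊ n /2⌋

3*2^⌊log₂[n/3]⌋≤n : ∀ n → 3 ≤ n → 3 ℕ.* 2 ^ ⌊log₂ (n ℕ./ 3) ⌋ ≤ n
3*2^⌊log₂[n/3]⌋≤n n 3≤n = begin
  3 ℕ.* 2 ^ ⌊log₂ (n ℕ./ 3) ⌋  ≤⟨ ℕ.*-monoʳ-≤ 3 (2^⌊log2⌋n≤n (n ℕ./ 3) {{n/3≢0}}) ⟩
  3 ℕ.* (n ℕ./ 3)             ≡⟨ ℕ.*-comm 3 (n ℕ./ 3) ⟩
  n ℕ./ 3 ℕ.* 3               ≤⟨ m/n*n≤m n 3 ⟩
  n                           ∎
  where
  open ℕ.≤-Reasoning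
  n/3≢0 = ℕ.>-nonZero (m≥n⇒m/n>0 3≤n)

lowerBound : ∀ {m₁ m₂ ℓ} a b → 4 ≤ m₁ → 3 ℕ.* 2 ^ a ≤ m₁ → 3 ℕ.* 2 ^ b ≤ m₂ →
             PMProperty m₁ m₂ ℓ → a ℕ.+ b ℕ.+ 4 ≤ ℓ
lowerBound {m₂ = m₂} {ℓ} zero b 4≤m₁ _ 3*2ᵇ≤m₂ property =
  subst (_≤ ℓ) (length b)
    (blocks-lowerBound 2 (suc b) [] [] property ℕ.≤-refl ℕ.≤-refl 4≤m₁ 2ᵇ⁺¹≤m₂ emptyCoreBound)
  where
  length : ∀ b → suc (2 ℕ.+ (suc b ℕ.+ 0)) ≡ b ℕ.+ 4
  length = ℕ-Solver.solve-∀
  2ᵇ⁺¹≤m₂ : 1 ℕ.* 2 ^ suc b ≤ m₂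
  2ᵇ⁺¹≤m₂ = begin
    1 ℕ.* (2 ℕ.* 2 ^ b)  ≡⟨ ℕ.*-identityˡ (2 ℕ.* 2 ^ b) ⟩
    2 ℕ.* 2 ^ b          ≤⟨ ℕ.*-monoˡ-≤ (2 ^ b) (ℕ.n≤1+n 2) ⟩
    3 ℕ.* 2 ^ b          ≤⟨ 3*2ᵇ≤m₂ ⟩
    m₂                   ∎
    where open ℕ.≤-Reasoning
lowerBound {ℓ = ℓ} (suc a) b _ 3*2ᵃ⁺¹≤m₁ 3*2ᵇ≤m₂ property =
  subst (_≤ ℓ) (cong suc (sym (ℕ.+-assoc a b 4)))
    (blocks-lowerBound a b coreˣ coreʸ property (s≤s z≤n) (s≤s z≤n)
      (ℕ.≤-trans (ℕ.≤-reflexive (ℕ.*-assoc 3 2 (2 ^ a))) 3*2ᵃ⁺¹≤m₁) 3*2ᵇ≤m₂ coreBound)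

proposition4p1 : (m₁ m₂ : ℕ) → 4 ≤ m₁ → 3 ≤ m₂ → (ℓ : ℕ) → IsDpm m₁ m₂ ℓ →
    ⌊log₂ (m₁ ℕ./ 3) ⌋ ℕ.+ ⌊log₂ (m₂ ℕ./ 3) ⌋ ℕ.+ 4 ≤ ℓ
proposition4p1 m₁ m₂ 4≤m₁ 3≤m₂ ℓ (_ , property , _) =
  lowerBound ⌊log₂ (m₁ ℕ./ 3) ⌋ ⌊log₂ (m₂ ℕ./ 3) ⌋ 4≤m₁
    (3*2^⌊log₂[n/3]⌋≤n m₁ (ℕ.≤-trans (ℕ.n≤1+n 3) 4≤m₁)) (3*2^⌊log₂[n/3]⌋≤n m₂ 3≤m₂) property
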